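{- Let $n\ge1$ and $P=\Phi^+(A_n)=\{(i,j)\colon 1\le i,j\le n,\ i+j\ge n+1\}$. Fix $k\in\{n-1,n-3,\dots,-(n-3),-(n-1)\}$. Then \[2\sum_{\substack{(i,j)\in P\\ j-i=k}}\mathbb{1}_{(i,j)}-\sum_{\substack{(i,j)\in P\\ j-i=k-1}}\mathbb{1}_{(i,j)}-\sum_{\substack{(i,j)\in P\\ j-i=k+1}}\mathbb{1}_{(i,j)}\equiv 1.\]
   Context: $P$ is ordered by $(i,j)\le(i',j')$ iff $i\le i'$ and $j\le j'$. $\mathcal{J}(P)$ is the set of order ideals of $P$. For $x\in P$, $I\in\mathcal{J}(P)$: $\mathbb{1}_x(I)=1$ if $x\in I$, else $0$; $T_x^+(I)=1$ if $x$ is a minimal element of $P\setminus I$, else $0$; $T_x^-(I)=1$ if $x$ is a maximal element of $I$, else $0$; $T_x=T_x^+-T_x^-$. For $f,g\colon\mathcal{J}(P)\to\mathbb{R}$, $f\equiv g$ means $f-g=\sum_{x\in P}c_xT_x$ for some real constants $c_x$; a real number denotes the corresponding constant function. -}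

module Defs where

open import Algebra.Bundles using (CommutativeRing)
open import Algebra.Structures using (IsCommutativeRing)
open import Data.Bool.Base using (Bool; T; if_then_else_)
open import Data.Bool.Properties using (T?)
open import Data.Fin.Base using (Fin; toℕ)
import Data.Fin.Properties as Fin
open import Data.Integer.Base as ℤ using (ℤ)
import Data.Integer.Properties as ℤ
open import Data.Nat.Base as ℕ using (ℕ; suc; _⊔_)
import Data.Nat.Properties as ℕ
open import Data.Product.Base using (Σ-syntax; ∃-syntax; _×_; _,_)
open import Data.Rational.Base as ℚ using (ℚ; 0ℚ; 1ℚ; ½; ∣_∣; Positive; positive; 1/_)
import Data.Rational.Properties as ℚ
open import Data.Rational.Solver using (module +-*-Solver)
open import Function.Base using (_∘_)
open import Relation.Binary.PropositionalEquality
  using (_≡_; refl; sym; trans; cong; subst)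
open import Relation.Binary.Structures using (IsEquivalence)
open import Relation.Nullary.Decidable
  using (Dec; yes; no; does; ¬?; _×-dec_; _→-dec_; map′)
open import Relation.Nullary.Negation using (contradiction)
open import Relation.Unary using (Pred; Decidable; U)
open import Relation.Unary.Properties using (U?)
open import Level using (0ℓ)

-- ℝ is the setoid of Cauchy sequences of rationals (each carrying a modulus of
-- convergence), with equality _≃_: the difference tends to 0.  Only the
-- commutative ring structure of ℝ enters the statement.

IsCauchy : (ℕ → ℚ) → Set
IsCauchy s = ∀ ε → 0ℚ ℚ.< ε →
  ∃[ N ] (∀ m n → N ℕ.≤ m → N ℕ.≤ n → ∣ s m ℚ.- s n ∣ ℚ.< ε)

record ℝ : Set where
  constructor mkℝ
  field
    seq    : ℕ → ℚ
    cauchy : IsCauchy seq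

open ℝ public

infix 4 _≃_

record _≃_ (x y : ℝ) : Set where
  constructor mk≃
  field
    close : ∀ ε → 0ℚ ℚ.< ε →
      ∃[ N ] (∀ n → N ℕ.≤ n → ∣ seq x n ℚ.- seq y n ∣ ℚ.< ε)

open _≃_ public

private
  abstract
    half-pos : ∀ {ε} → 0ℚ ℚ.< ε → 0ℚ ℚ.< ½ ℚ.* ε
    half-pos {ε} 0<ε = ℚ.positive⁻¹ (½ ℚ.* ε) {{ℚ.pos*pos⇒pos ½ ε {{positive 0<ε}}}}

    halves : ∀ ε → ½ ℚ.* ε ℚ.+ ½ ℚ.* ε ≡ ε
    halves ε = trans (sym (ℚ.*-distribʳ-+ ε ½ ½)) (ℚ.*-identityˡ ε)

    split< : ∀ p q {r ε} → r ≡ p ℚ.+ q →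
             ∣ p ∣ ℚ.< ½ ℚ.* ε → ∣ q ∣ ℚ.< ½ ℚ.* ε → ∣ r ∣ ℚ.< ε
    split< p q {ε = ε} refl p< q< = ℚ.≤-<-trans (ℚ.∣p+q∣≤∣p∣+∣q∣ p q)
      (subst (_ ℚ.<_) (halves ε) (ℚ.+-mono-< p< q<))

    dist-sym : ∀ p q → ∣ p ℚ.- q ∣ ≡ ∣ q ℚ.- p ∣
    dist-sym p q = trans (sym (ℚ.∣-p∣≡∣p∣ (p ℚ.- q)))
      (cong ∣_∣ (solve 2 (λ a b → :- (a :- b) := b :- a) refl p q))
      where open +-*-Solver

    dist-refl : ∀ {p q ε} → p ≡ q → 0ℚ ℚ.< ε → ∣ p ℚ.- q ∣ ℚ.< ε
    dist-refl {p} {ε = ε} refl 0<ε = subst (λ r → ∣ r ∣ ℚ.< ε) (sym (ℚ.+-inverseʳ p)) 0<ε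

    +-dist : ∀ a b c d →
             (a ℚ.+ b) ℚ.- (c ℚ.+ d) ≡ (a ℚ.- c) ℚ.+ (b ℚ.- d)
    +-dist = solve 4 (λ a b c d → (a :+ b) :- (c :+ d) := (a :- c) :+ (b :- d)) refl
      where open +-*-Solver

    *-dist : ∀ a b c d →
             (a ℚ.* b) ℚ.- (c ℚ.* d) ≡ a ℚ.* (b ℚ.- d) ℚ.+ d ℚ.* (a ℚ.- c)
    *-dist = solve 4 (λ a b c d →
      (a :* b) :- (c :* d) := a :* (b :- d) :+ d :* (a :- c)) refl
      where open +-*-Solver

    neg-dist : ∀ a b → (ℚ.- a) ℚ.- (ℚ.- b) ≡ b ℚ.- a
    neg-dist = solve 2 (λ a b → (:- a) :- (:- b) := b :- a) refl
      where open +-*-Solver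

    dist-trans : ∀ a b c → a ℚ.- c ≡ (a ℚ.- b) ℚ.+ (b ℚ.- c)
    dist-trans = solve 3 (λ a b c → a :- c := (a :- b) :+ (b :- c)) refl
      where open +-*-Solver

    scaled : ∀ B → 0ℚ ℚ.< B → ∀ ε → 0ℚ ℚ.< ε →
             Σ[ δ ∈ ℚ ] 0ℚ ℚ.< δ ×
               (∀ a d → ∣ a ∣ ℚ.≤ B → ∣ d ∣ ℚ.< δ → ∣ a ℚ.* d ∣ ℚ.< ε)
    scaled B 0<B ε 0<ε = δ , ℚ.positive⁻¹ δ , bound
      where
      instance
        B⁺ : Positive B
        B⁺ = positive 0<B
        B≢0 : ℚ.NonZero B
        B≢0 = ℚ.pos⇒nonZero B
        ε⁺ : Positive ε
        ε⁺ = positive 0<ε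
      δ : ℚ
      δ = 1/ B ℚ.* ε
      instance
        δ⁺ : Positive δ
        δ⁺ = ℚ.pos*pos⇒pos (1/ B) {{ℚ.1/pos⇒pos B}} ε
      Bδ≡ε : B ℚ.* δ ≡ ε
      Bδ≡ε = trans (sym (ℚ.*-assoc B (1/ B) ε))
        (trans (cong (ℚ._* ε) (ℚ.*-inverseʳ B)) (ℚ.*-identityˡ ε))
      bound : ∀ a d → ∣ a ∣ ℚ.≤ B → ∣ d ∣ ℚ.< δ → ∣ a ℚ.* d ∣ ℚ.< ε
      bound a d a≤B d<δ = subst (ℚ._< ε) (sym (ℚ.∣p*q∣≡∣p∣*∣q∣ a d))
        (ℚ.≤-<-trans (ℚ.*-monoʳ-≤-nonNeg ∣ d ∣ {{ℚ.∣-∣-nonNeg d}} a≤B)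
          (subst (B ℚ.* ∣ d ∣ ℚ.<_) Bδ≡ε (ℚ.*-monoʳ-<-pos B d<δ)))

    0<1 : 0ℚ ℚ.< 1ℚ
    0<1 = ℚ.positive⁻¹ 1ℚ

    recombine : ∀ a b → a ℚ.+ (b ℚ.- a) ≡ b
    recombine = solve 2 (λ a b → a :+ (b :- a) := b) refl
      where open +-*-Solver

    bounded : ∀ {s} → IsCauchy s →
              Σ[ B ∈ ℚ ] 0ℚ ℚ.< B × ∃[ N ] (∀ n → N ℕ.≤ n → ∣ s n ∣ ℚ.≤ B)
    bounded {s} cs =
      let N , near = cs 1ℚ 0<1
      in ∣ s N ∣ ℚ.+ 1ℚ
       , ℚ.+-mono-≤-< (ℚ.0≤∣p∣ (s N)) 0<1
       , N
       , λ n N≤n → subst (λ r → ∣ r ∣ ℚ.≤ ∣ s N ∣ ℚ.+ 1ℚ) (recombine (s N) (s n))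
           (ℚ.≤-trans (ℚ.∣p+q∣≤∣p∣+∣q∣ (s N) (s n ℚ.- s N))
             (ℚ.+-monoʳ-≤ ∣ s N ∣ (ℚ.<⇒≤ (near n N N≤n ℕ.≤-refl))))

    const-cauchy : ∀ q → IsCauchy (λ _ → q)
    const-cauchy q ε 0<ε = 0 , λ _ _ _ _ → dist-refl {q} refl 0<ε

    +-cauchy : ∀ {s t} → IsCauchy s → IsCauchy t → IsCauchy (λ n → s n ℚ.+ t n)
    +-cauchy {s} {t} cs ct ε 0<ε =
     let M , p = cs (½ ℚ.* ε) (half-pos 0<ε)
         N , q = ct (½ ℚ.* ε) (half-pos 0<ε)
     in M ⊔ N , λ m n m≥ n≥ →
      split< (s m ℚ.- s n) (t m ℚ.- t n) (+-dist (s m) (t m) (s n) (t n))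
        (p m n (ℕ.m⊔n≤o⇒m≤o M N m≥) (ℕ.m⊔n≤o⇒m≤o M N n≥))
        (q m n (ℕ.m⊔n≤o⇒n≤o M N m≥) (ℕ.m⊔n≤o⇒n≤o M N n≥))

    neg-cauchy : ∀ {s} → IsCauchy s → IsCauchy (λ n → ℚ.- s n)
    neg-cauchy {s} cs ε 0<ε =
      let N , p = cs ε 0<ε in N , λ m n m≥ n≥ →
      subst (λ r → ∣ r ∣ ℚ.< ε) (sym (neg-dist (s m) (s n))) (p n m n≥ m≥)

    *-cauchy : ∀ {s t} → IsCauchy s → IsCauchy t → IsCauchy (λ n → s n ℚ.* t n)
    *-cauchy {s} {t} cs ct ε 0<ε =
      let B , 0<B , K , s≤B = bounded {s} cs
          C , 0<C , L , t≤C = bounded {t} ct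
          δ , 0<δ , sc = scaled B 0<B (½ ℚ.* ε) (half-pos 0<ε)
          γ , 0<γ , tc = scaled C 0<C (½ ℚ.* ε) (half-pos 0<ε)
          M , p = ct δ 0<δ
          N , q = cs γ 0<γ
      in (K ⊔ L) ⊔ (M ⊔ N) , λ m n m≥ n≥ →
        let KLm = ℕ.m⊔n≤o⇒m≤o (K ⊔ L) (M ⊔ N) m≥
            KLn = ℕ.m⊔n≤o⇒m≤o (K ⊔ L) (M ⊔ N) n≥
            MNm = ℕ.m⊔n≤o⇒n≤o (K ⊔ L) (M ⊔ N) m≥
            MNn = ℕ.m⊔n≤o⇒n≤o (K ⊔ L) (M ⊔ N) n≥
        in split< (s m ℚ.* (t m ℚ.- t n)) (t n ℚ.* (s m ℚ.- s n))
             (*-dist (s m) (t m) (s n) (t n))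
             (sc (s m) (t m ℚ.- t n) (s≤B m (ℕ.m⊔n≤o⇒m≤o K L KLm))
               (p m n (ℕ.m⊔n≤o⇒m≤o M N MNm) (ℕ.m⊔n≤o⇒m≤o M N MNn)))
             (tc (t n) (s m ℚ.- s n) (t≤C n (ℕ.m⊔n≤o⇒n≤o K L KLn))
               (q m n (ℕ.m⊔n≤o⇒n≤o M N MNm) (ℕ.m⊔n≤o⇒n≤o M N MNn)))

infixl 6 _+ℝ_
infixl 7 _*ℝ_
infix  8 -ℝ_

fromℚ : ℚ → ℝ
fromℚ q = mkℝ (λ _ → q) (const-cauchy q)

_+ℝ_ _*ℝ_ : ℝ → ℝ → ℝ
x +ℝ y = mkℝ (λ n → seq x n ℚ.+ seq y n) (+-cauchy {seq x} {seq y} (cauchy x) (cauchy y))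
x *ℝ y = mkℝ (λ n → seq x n ℚ.* seq y n) (*-cauchy {seq x} {seq y} (cauchy x) (cauchy y))

-ℝ_ : ℝ → ℝ
-ℝ x = mkℝ (λ n → ℚ.- seq x n) (neg-cauchy {seq x} (cauchy x))

0ℝ 1ℝ 2ℝ : ℝ
0ℝ = fromℚ 0ℚ
1ℝ = fromℚ 1ℚ
2ℝ = fromℚ (ℤ.+ 2 ℚ./ 1)

abstract
  ≗⇒≃ : ∀ {x y} → (∀ n → seq x n ≡ seq y n) → x ≃ y
  ≗⇒≃ eq = mk≃ λ ε 0<ε → 0 , λ n _ → dist-refl (eq n) 0<ε

  ≃-isEquivalence : IsEquivalence _≃_
  ≃-isEquivalence = record
    { refl  = ≗⇒≃ (λ _ → refl)
    ; sym   = λ {x} {y} x≃y → mk≃ λ ε 0<ε →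
        let N , p = close x≃y ε 0<ε
        in N , λ n n≥ → subst (ℚ._< ε) (dist-sym (seq x n) (seq y n)) (p n n≥)
    ; trans = λ {x} {y} {z} x≃y y≃z → mk≃ λ ε 0<ε →
        let M , p = close x≃y (½ ℚ.* ε) (half-pos 0<ε)
            N , q = close y≃z (½ ℚ.* ε) (half-pos 0<ε)
        in M ⊔ N , λ n n≥ →
          split< (seq x n ℚ.- seq y n) (seq y n ℚ.- seq z n)
            (dist-trans (seq x n) (seq y n) (seq z n))
            (p n (ℕ.m⊔n≤o⇒m≤o M N n≥)) (q n (ℕ.m⊔n≤o⇒n≤o M N n≥))
    }

  +ℝ-cong : ∀ {x y u v} → x ≃ y → u ≃ v → x +ℝ u ≃ y +ℝ v
  +ℝ-cong {x} {y} {u} {v} x≃y u≃v = mk≃ λ ε 0<ε →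
    let M , p = close x≃y (½ ℚ.* ε) (half-pos 0<ε)
        N , q = close u≃v (½ ℚ.* ε) (half-pos 0<ε)
    in M ⊔ N , λ n n≥ →
      split< (seq x n ℚ.- seq y n) (seq u n ℚ.- seq v n)
        (+-dist (seq x n) (seq u n) (seq y n) (seq v n))
        (p n (ℕ.m⊔n≤o⇒m≤o M N n≥)) (q n (ℕ.m⊔n≤o⇒n≤o M N n≥))

  *ℝ-cong : ∀ {x y u v} → x ≃ y → u ≃ v → x *ℝ u ≃ y *ℝ v
  *ℝ-cong {x} {y} {u} {v} x≃y u≃v = mk≃ λ ε 0<ε →
    let B , 0<B , K , x≤B = bounded {seq x} (cauchy x)
        C , 0<C , L , v≤C = bounded {seq v} (cauchy v)
        δ , 0<δ , sc = scaled B 0<B (½ ℚ.* ε) (half-pos 0<ε)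
        γ , 0<γ , tc = scaled C 0<C (½ ℚ.* ε) (half-pos 0<ε)
        M , p = close u≃v δ 0<δ
        N , q = close x≃y γ 0<γ
    in (K ⊔ L) ⊔ (M ⊔ N) , λ n n≥ →
      let KL = ℕ.m⊔n≤o⇒m≤o (K ⊔ L) (M ⊔ N) n≥
          MN = ℕ.m⊔n≤o⇒n≤o (K ⊔ L) (M ⊔ N) n≥
      in split< (seq x n ℚ.* (seq u n ℚ.- seq v n)) (seq v n ℚ.* (seq x n ℚ.- seq y n))
           (*-dist (seq x n) (seq u n) (seq y n) (seq v n))
           (sc (seq x n) (seq u n ℚ.- seq v n) (x≤B n (ℕ.m⊔n≤o⇒m≤o K L KL)) (p n (ℕ.m⊔n≤o⇒m≤o M N MN)))
           (tc (seq v n) (seq x n ℚ.- seq y n) (v≤C n (ℕ.m⊔n≤o⇒n≤o K L KL)) (q n (ℕ.m⊔n≤o⇒n≤o M N MN)))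

  -ℝ-cong : ∀ {x y} → x ≃ y → -ℝ x ≃ -ℝ y
  -ℝ-cong {x} {y} x≃y = mk≃ λ ε 0<ε →
    let N , p = close (IsEquivalence.sym ≃-isEquivalence x≃y) ε 0<ε
    in N , λ n n≥ →
      subst (λ r → ∣ r ∣ ℚ.< ε) (sym (neg-dist (seq x n) (seq y n))) (p n n≥)

  ℝ-isCommutativeRing : IsCommutativeRing _≃_ _+ℝ_ _*ℝ_ -ℝ_ 0ℝ 1ℝ
  ℝ-isCommutativeRing = record
    { isRing = record
      { +-isAbelianGroup = record
        { isGroup = record
          { isMonoid = record
            { isSemigroup = record
              { isMagma = record
                { isEquivalence = ≃-isEquivalence
                ; ∙-cong = +ℝ-cong
                }
              ; assoc = λ x y z → ≗⇒≃ λ n → ℚ.+-assoc (seq x n) (seq y n) (seq z n)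
              }
            ; identity = (λ x → ≗⇒≃ λ n → ℚ.+-identityˡ (seq x n))
                       , (λ x → ≗⇒≃ λ n → ℚ.+-identityʳ (seq x n))
            }
          ; inverse = (λ x → ≗⇒≃ λ n → ℚ.+-inverseˡ (seq x n))
                    , (λ x → ≗⇒≃ λ n → ℚ.+-inverseʳ (seq x n))
          ; ⁻¹-cong = -ℝ-cong
          }
        ; comm = λ x y → ≗⇒≃ λ n → ℚ.+-comm (seq x n) (seq y n)
        }
      ; *-cong = *ℝ-cong
      ; *-assoc = λ x y z → ≗⇒≃ λ n → ℚ.*-assoc (seq x n) (seq y n) (seq z n)
      ; *-identity = (λ x → ≗⇒≃ λ n → ℚ.*-identityˡ (seq x n))
                   , (λ x → ≗⇒≃ λ n → ℚ.*-identityʳ (seq x n))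
      ; distrib = (λ x y z → ≗⇒≃ λ n → ℚ.*-distribˡ-+ (seq x n) (seq y n) (seq z n))
                , (λ x y z → ≗⇒≃ λ n → ℚ.*-distribʳ-+ (seq x n) (seq y n) (seq z n))
      }
    ; *-comm = λ x y → ≗⇒≃ λ n → ℚ.*-comm (seq x n) (seq y n)
    }

ℝ-commutativeRing : CommutativeRing 0ℓ 0ℓ
ℝ-commutativeRing = record { isCommutativeRing = ℝ-isCommutativeRing }

infixl 6 _-ℝ_

_-ℝ_ : ℝ → ℝ → ℝ
_-ℝ_ = CommutativeRing._-_ ℝ-commutativeRing

open import Algebra.Properties.Monoid.Sum (CommutativeRing.+-monoid ℝ-commutativeRing)
  using (sum-syntax)

-- `Fin n` is zero-based, so the coordinate i ∈ {1, …, n} is `coord a`.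
coord : ∀ {n} → Fin n → ℕ
coord a = suc (toℕ a)

InΦ⁺ : ∀ {n} → Fin n → Fin n → Set
InΦ⁺ {n} a b = suc n ℕ.≤ coord a ℕ.+ coord b

InΦ⁺? : ∀ {n} (a b : Fin n) → Dec (InΦ⁺ a b)
InΦ⁺? {n} a b = suc n ℕ.≤? coord a ℕ.+ coord b

record Φ⁺A (n : ℕ) : Set where
  constructor root
  field
    fst   : Fin n
    snd   : Fin n
    bound : InΦ⁺ fst snd

  i j : ℕ
  i = coord fst
  j = coord snd

open Φ⁺A public using (i; j)

infix 4 _⊑_ _⊑?_ _≟Φ_

_⊑_ : ∀ {n} → Φ⁺A n → Φ⁺A n → Set
x ⊑ y = i x ℕ.≤ i y × j x ℕ.≤ j y

_⊑?_ : ∀ {n} (x y : Φ⁺A n) → Dec (x ⊑ y)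
x ⊑? y = (i x ℕ.≤? i y) ×-dec (j x ℕ.≤? j y)

_≟Φ_ : ∀ {n} (x y : Φ⁺A n) → Dec (x ≡ y)
root a b p ≟Φ root c d q = map′
  (λ { (refl , refl) → cong (root a b) (ℕ.≤-irrelevant p q) })
  (λ { refl → refl , refl })
  ((a Fin.≟ c) ×-dec (b Fin.≟ d))

allΦ? : ∀ {n} {Q : Pred (Φ⁺A n) 0ℓ} → Decidable Q → Dec (∀ x → Q x)
allΦ? {n} {Q} Q? = map′
  (λ { h (root a b p) → h a b p })
  (λ h a b p → h (root a b p))
  (Fin.all? λ a → Fin.all? λ b → at a b)
  where
  at : ∀ a b → Dec (∀ p → Q (root a b p))
  at a b with InΦ⁺? a b
  ... | no ¬p = yes λ p → contradiction p ¬p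
  ... | yes p = map′ (λ q p′ → subst (Q ∘ root a b) (ℕ.≤-irrelevant p p′) q)
                     (λ h → h p) (Q? (root a b p))

-- Sums over Φ⁺(Aₙ), or over a decidable part Q of it, run over the whole
-- square {1,…,n}², with the summand extended by 0.
extend0 : ∀ {n} {Q : Pred (Φ⁺A n) 0ℓ} → Decidable Q → (Φ⁺A n → ℝ) → Fin n → Fin n → ℝ
extend0 Q? f a b with InΦ⁺? a b
... | no _  = 0ℝ
... | yes p = if does (Q? (root a b p)) then f (root a b p) else 0ℝ

sumΦ : ∀ {n} {Q : Pred (Φ⁺A n) 0ℓ} → Decidable Q → (Φ⁺A n → ℝ) → ℝ
sumΦ {n} Q? f = ∑[ a < n ] ∑[ b < n ] extend0 Q? f a b

-- Φ⁺(Aₙ) is finite, so its subsets are given by Boolean characteristic functions.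
record 𝒥 (n : ℕ) : Set where
  field
    mem        : Φ⁺A n → Bool
    downClosed : ∀ {x y} → x ⊑ y → T (mem y) → T (mem x)

open 𝒥 public

infix 4 _∈_ _∈?_

_∈_ : ∀ {n} → Φ⁺A n → 𝒥 n → Set
x ∈ I = T (mem I x)

_∈?_ : ∀ {n} (x : Φ⁺A n) (I : 𝒥 n) → Dec (x ∈ I)
x ∈? I = T? (mem I x)

IsMinimalIn IsMaximalIn : ∀ {n} → Pred (Φ⁺A n) 0ℓ → Pred (Φ⁺A n) 0ℓ
IsMinimalIn S x = S x × (∀ y → S y → y ⊑ x → y ≡ x)
IsMaximalIn S x = S x × (∀ y → S y → x ⊑ y → y ≡ x)

isMinimalIn? : ∀ {n} {S : Pred (Φ⁺A n) 0ℓ} → Decidable S → Decidable (IsMinimalIn S)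
isMinimalIn? S? x = S? x ×-dec allΦ? λ y → S? y →-dec (y ⊑? x →-dec y ≟Φ x)

isMaximalIn? : ∀ {n} {S : Pred (Φ⁺A n) 0ℓ} → Decidable S → Decidable (IsMaximalIn S)
isMaximalIn? S? x = S? x ×-dec allΦ? λ y → S? y →-dec (x ⊑? y →-dec y ≟Φ x)

indicator : ∀ {A : Set} → Dec A → ℝ
indicator d = if does d then 1ℝ else 0ℝ

-- Tog x is the toggleability statistic Tₓ = Tₓ⁺ - Tₓ⁻.
𝟙 T⁺ T⁻ Tog : ∀ {n} → Φ⁺A n → 𝒥 n → ℝ
𝟙   x I = indicator (x ∈? I)
T⁺  x I = indicator (isMinimalIn? (λ y → ¬? (y ∈? I)) x)
T⁻  x I = indicator (isMaximalIn? (_∈? I) x)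
Tog x I = T⁺ x I -ℝ T⁻ x I

infix 3 _≡ᵀ_

_≡ᵀ_ : ∀ {n} → (𝒥 n → ℝ) → (𝒥 n → ℝ) → Set
_≡ᵀ_ {n} f g = Σ[ c ∈ (Φ⁺A n → ℝ) ]
  (∀ I → f I -ℝ g I ≃ sumΦ U? (λ x → c x *ℝ Tog x I))

file : ∀ {n} → ℤ → 𝒥 n → ℝ
file k I = sumΦ (λ x → (ℤ.+ j x ℤ.- ℤ.+ i x) ℤ.≟ k) (λ x → 𝟙 x I)

{-# OPTIONS --safe #-}
-- Use zero-based coordinates and let x₀ < x₁ < … be the diagonal j - i = k, where x₀ is a
-- minimal root.  Write u_t and v_t for the two upper covers of x_t; they run over the
-- files k - 1 and k + 1, and they are the lower covers of x_{t+1}.  With p₀ = 1 and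
-- p_{t+1} = 𝟙(u_t) 𝟙(v_t) this gives T⁺(x_t) = p_t - 𝟙(x_t) and, by inclusion–exclusion,
-- T⁻(x_t) = 𝟙(x_t) - 𝟙(u_t) - 𝟙(v_t) + p_{t+1}.  Summed along the diagonal, -T(x_t)
-- telescopes to the second difference of the file sums minus 1, so c = -1 on the file k
-- and c = 0 elsewhere.

module Submission where

open import Data.Nat.Base using (ℕ; _≤_; _<_)
open import Data.Integer.Base using (ℤ; +_; _+_; _-_; _*_)
open import Data.Product.Base using (∃-syntax; _×_)
open import Relation.Binary.PropositionalEquality using (_≡_)
open import Defs

open import Algebra.Bundles using (CommutativeRing)
open import Data.Bool.Base using (Bool; true; false; T; _∧_; not; if_then_else_)
open import Data.Bool.Properties using (T?; T-∧; if-eta)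
open import Data.Empty using (⊥-elim)
open import Data.Fin.Base using (Fin; toℕ; fromℕ<; zero; suc)
open import Data.Fin.Properties using (toℕ-injective; toℕ<n; toℕ-fromℕ<)
import Data.Integer.Base as ℤ
import Data.Integer.Properties as ℤ
import Data.Integer.Solver as ℤ-Solver
open import Data.Nat.Base as ℕ using (zero; suc; s≤s)
import Data.Nat.Properties as ℕ
open import Data.Product.Base using (_,_; proj₁; proj₂)
import Data.Rational.Base as ℚ
open import Data.Rational.Solver using (module +-*-Solver)
open import Data.Sum.Base using (inj₁; inj₂)
open import Data.Unit.Base using (tt)
open import Function.Base using (_∘_)
open import Function.Bundles using (_⇔_; mk⇔; Equivalence)
open import Level using (0ℓ)
open import Relation.Binary.PropositionalEquality
  using (_≢_; refl; sym; trans; cong; cong₂; subst; subst₂; module ≡-Reasoning)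
open import Relation.Nullary.Decidable
  using (Dec; yes; no; does; map′; _×-dec_; ¬?; dec-true; dec-false; does-⇔)
open import Relation.Nullary.Negation using (¬_; contradiction)
open import Relation.Unary using (Pred; Decidable)
open import Relation.Unary.Properties using (U?)

private
  module R = CommutativeRing ℝ-commutativeRing

open import Algebra.Properties.CommutativeMonoid.Sum R.+-commutativeMonoid
  using (sum; sum-syntax; sum-cong-≋; ∑-comm)
import Relation.Binary.Reasoning.Setoid R.setoid as ≃-Reasoning

-- Finite sums over ℝ and telescoping.

sum-zero : ∀ {n} (f : Fin n → ℝ) → (∀ i → f i ≃ 0ℝ) → sum f ≃ 0ℝ
sum-zero {zero}  f f≃0 = R.refl
sum-zero {suc n} f f≃0 =
  R.trans (R.+-cong (f≃0 zero) (sum-zero (f ∘ suc) (f≃0 ∘ suc))) (R.+-identityˡ 0ℝ)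

sum-single : ∀ {n} (f : Fin n → ℝ) i → (∀ j → j ≢ i → f j ≃ 0ℝ) → sum f ≃ f i
sum-single f zero    off =
  R.trans (R.+-congˡ (sum-zero (f ∘ suc) λ j → off (suc j) λ ())) (R.+-identityʳ (f zero))
sum-single f (suc i) off =
  R.trans (R.+-cong (off zero λ ()) (sum-single (f ∘ suc) i λ j j≢i → off (suc j) λ { refl → j≢i refl }))
    (R.+-identityˡ (f (suc i)))

-- Induction on `N` peels off the term at 0 and shifts all five sequences by one, so the `p 1` left
-- over from the first step is the initial term of the shifted sum. Both boundary terms stay
-- visible: later `p 0` becomes the constant 1 and `p N` vanishes.
∑-telescope : ∀ N (x u v p σ : ℕ → ℝ) →
  (∀ t → σ t ≃ (x t +ℝ x t -ℝ (u t +ℝ v t)) -ℝ (p t -ℝ p (suc t))) →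
  2ℝ *ℝ ∑[ t < N ] x (toℕ t) -ℝ ∑[ t < N ] u (toℕ t) -ℝ ∑[ t < N ] v (toℕ t) -ℝ p 0
    ≃ ∑[ t < N ] σ (toℕ t) -ℝ p N
∑-telescope zero x u v p σ eq = ≗⇒≃ λ i →
  solve 1 (λ a → con (ℤ.+ 2 ℚ./ 1) :* con ℚ.0ℚ :- con ℚ.0ℚ :- con ℚ.0ℚ :- a := con ℚ.0ℚ :- a) refl (seq (p 0) i)
  where open +-*-Solver
∑-telescope (suc N) x u v p σ eq = begin
  2ℝ *ℝ (x 0 +ℝ X) -ℝ (u 0 +ℝ U) -ℝ (v 0 +ℝ V) -ℝ p 0
    ≈⟨ ≗⇒≃ (λ i → solve 8 (λ x X u U v V p p′ →
         con (ℤ.+ 2 ℚ./ 1) :* (x :+ X) :- (u :+ U) :- (v :+ V) :- p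
         := ((x :+ x :- (u :+ v)) :- (p :- p′))
            :+ (con (ℤ.+ 2 ℚ./ 1) :* X :- U :- V :- p′)) refl
         (seq (x 0) i) (seq X i) (seq (u 0) i) (seq U i) (seq (v 0) i) (seq V i) (seq (p 0) i) (seq (p 1) i)) ⟩
  ((x 0 +ℝ x 0 -ℝ (u 0 +ℝ v 0)) -ℝ (p 0 -ℝ p 1)) +ℝ (2ℝ *ℝ X -ℝ U -ℝ V -ℝ p 1)
    ≈⟨ R.+-cong (R.sym (eq 0))
         (∑-telescope N (x ∘ suc) (u ∘ suc) (v ∘ suc) (p ∘ suc) (σ ∘ suc) (eq ∘ suc)) ⟩
  σ 0 +ℝ (S -ℝ p (suc N))
    ≈⟨ R.+-assoc (σ 0) S (-ℝ p (suc N)) ⟨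
  σ 0 +ℝ S -ℝ p (suc N) ∎
  where
  open ≃-Reasoning
  open +-*-Solver
  X = ∑[ t < N ] x (suc (toℕ t))
  U = ∑[ t < N ] u (suc (toℕ t))
  V = ∑[ t < N ] v (suc (toℕ t))
  S = ∑[ t < N ] σ (suc (toℕ t))

-- Roots as points of ℕ × ℕ.

-- The zero-based coordinates of a root; as a + b + 2 ≥ n + 1, they satisfy n ≤ 1 + a + b.
At : ∀ {n} → Φ⁺A n → ℕ → ℕ → Set
At x a b = toℕ (Φ⁺A.fst x) ≡ a × toℕ (Φ⁺A.snd x) ≡ b

module _ {n : ℕ} where

  at-unique : ∀ {x y : Φ⁺A n} {a b} → At x a b → At y a b → x ≡ y
  at-unique {root a b p} {root c d q} (refl , refl) (e , f)
    with refl ← toℕ-injective e | refl ← toℕ-injective f = cong (root a b) (ℕ.≤-irrelevant p q)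

  at-<ˡ : ∀ {x : Φ⁺A n} {a b} → At x a b → a < n
  at-<ˡ {root a b p} (refl , refl) = toℕ<n a

  at-<ʳ : ∀ {x : Φ⁺A n} {a b} → At x a b → b < n
  at-<ʳ {root a b p} (refl , refl) = toℕ<n b

  at-bound : ∀ {x : Φ⁺A n} {a b} → At x a b → n ≤ suc (a ℕ.+ b)
  at-bound {root a b p} (refl , refl) = ℕ.s≤s⁻¹ (subst (suc n ≤_) (cong suc (ℕ.+-suc (toℕ a) (toℕ b))) p)

  cell : ∀ {a b} → a < n → b < n → n ≤ suc (a ℕ.+ b) → ∃[ x ] At {n} x a b
  cell {a} {b} a<n b<n h = root (fromℕ< a<n) (fromℕ< b<n) bound , toℕ-fromℕ< a<n , toℕ-fromℕ< b<n
    where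
    bound : InΦ⁺ (fromℕ< a<n) (fromℕ< b<n)
    bound = subst₂ (λ c d → suc n ≤ suc c ℕ.+ suc d) (sym (toℕ-fromℕ< a<n)) (sym (toℕ-fromℕ< b<n))
      (subst (suc n ≤_) (sym (cong suc (ℕ.+-suc a b))) (s≤s h))

  locate : ∀ a b → Dec (∃[ x ] At {n} x a b)
  locate a b = map′
    (λ { (a<n , b<n , h) → cell a<n b<n h })
    (λ { (x , at) → at-<ˡ {x} at , at-<ʳ {x} at , at-bound {x} at })
    ((a ℕ.<? n) ×-dec (b ℕ.<? n) ×-dec (n ℕ.≤? suc (a ℕ.+ b)))

  module _ {A : Set} (z : A) (h : Φ⁺A n → A) where

    -- Being total on ℕ × ℕ, it can be evaluated along a whole diagonal and at the neighbours of a
    -- root, with `z` standing in for points that are not roots.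
    ext : ℕ → ℕ → A
    ext a b with locate a b
    ... | yes (x , _) = h x
    ... | no  _       = z

    ext-at : ∀ {x a b} → At x a b → ext a b ≡ h x
    ext-at {x} {a} {b} at with locate a b
    ... | yes (y , at′) = cong h (at-unique {y} {x} at′ at)
    ... | no ¬at        = contradiction (x , at) ¬at

    ext-off : ∀ {a b} → ¬ (∃[ x ] At x a b) → ext a b ≡ z
    ext-off {a} {b} off with locate a b
    ... | yes at = contradiction at off
    ... | no _   = refl

  ext-natural : ∀ {A B : Set} (g : A → B) z h a b → ext (g z) (g ∘ h) a b ≡ g (ext z h a b)
  ext-natural g z h a b with locate a b
  ... | yes _ = refl
  ... | no _  = refl

  extend0≡ext : ∀ {Q : Pred (Φ⁺A n) 0ℓ} (Q? : Decidable Q) f a b →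
    extend0 Q? f a b ≡ ext 0ℝ (λ x → if does (Q? x) then f x else 0ℝ) (toℕ a) (toℕ b)
  extend0≡ext Q? f a b with InΦ⁺? a b
  ... | yes p = sym (ext-at _ _ {root a b p} (refl , refl))
  ... | no ¬p = sym (ext-off _ _ λ { (root c d q , e , e′) →
    ¬p (subst₂ InΦ⁺ (toℕ-injective e) (toℕ-injective e′) q) })

-- File sums as sums along a diagonal.

InFile? : ∀ {n} (k : ℤ) → Decidable (λ (x : Φ⁺A n) → + j x - + i x ≡ k)
InFile? k x = (+ j x - + i x) ℤ.≟ k

-- Trades an equation between integer differences for one between sums of naturals, where a point
-- can be compared with the start of its diagonal.
+-difference : ∀ a b c d → (+ b - + a ≡ + d - + c) ⇔ (b ℕ.+ c ≡ a ℕ.+ d)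
+-difference a b c d = mk⇔
  (λ e → ℤ.+-injective (trans (move (+ a) (+ b) (+ c))
    (trans (cong (_+ (+ a + + c)) e) (back (+ a) (+ c) (+ d)))))
  (λ e → trans (move′ (+ a) (+ b) (+ c))
    (trans (cong (λ s → + s - (+ a + + c)) e) (back′ (+ a) (+ c) (+ d))))
  where
  open ℤ-Solver.+-*-Solver
  move : ∀ a b c → b + c ≡ (b - a) + (a + c)
  move = solve 3 (λ a b c → b :+ c := (b :- a) :+ (a :+ c)) refl
  back : ∀ a c d → (d - c) + (a + c) ≡ a + d
  back = solve 3 (λ a c d → (d :- c) :+ (a :+ c) := a :+ d) refl
  move′ : ∀ a b c → b - a ≡ (b + c) - (a + c)
  move′ = solve 3 (λ a b c → b :- a := (b :+ c) :- (a :+ c)) refl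
  back′ : ∀ a c d → (a + d) - (a + c) ≡ d - c
  back′ = solve 3 (λ a c d → (a :+ d) :- (a :+ c) := d :- c) refl

-- The diagonal from (p , q) may start outside Φ⁺ or leave it before t = n; ext is 0 there.
module _ {n : ℕ} (p q : ℕ) (p+q≤n : p ℕ.+ q ≤ n) (f : Φ⁺A n → ℝ) where

  private
    onDiagonal? : ∀ t a b → Dec (p ℕ.+ t ≡ a × q ℕ.+ t ≡ b)
    onDiagonal? t a b = (p ℕ.+ t ℕ.≟ a) ×-dec (q ℕ.+ t ℕ.≟ b)

    -- For fixed `t` this matrix is supported on the single point `(p + t , q + t)`. Adding up over
    -- `t` spreads `f` along the diagonal, so that the order of summation can be exchanged.
    term : ℕ → ℕ → ℕ → ℝ
    term t a b = if does (onDiagonal? t a b) then ext 0ℝ f a b else 0ℝ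

    term-on : ∀ {t a b} → p ℕ.+ t ≡ a → q ℕ.+ t ≡ b → term t a b ≡ ext 0ℝ f a b
    term-on {t} {a} {b} e e′ = cong (if_then ext 0ℝ f a b else 0ℝ) (dec-true (onDiagonal? t a b) (e , e′))

    term-off : ∀ {t a b} → ¬ (p ℕ.+ t ≡ a × q ℕ.+ t ≡ b) → term t a b ≡ 0ℝ
    term-off {t} {a} {b} ¬e = cong (if_then ext 0ℝ f a b else 0ℝ) (dec-false (onDiagonal? t a b) ¬e)

    term-outside : ∀ t {a b} → ¬ (∃[ x ] At {n} x a b) → term t a b ≡ 0ℝ
    term-outside t {a} {b} off =
      trans (cong (if does (onDiagonal? t a b) then_else 0ℝ) (ext-off 0ℝ f off))
        (if-eta (does (onDiagonal? t a b)))

    on-line : ∀ t {a b} → p ℕ.+ t ≡ a → q ℕ.+ t ≡ b → b ℕ.+ p ≡ a ℕ.+ q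
    on-line t refl refl = begin
      (q ℕ.+ t) ℕ.+ p ≡⟨ ℕ.+-comm _ p ⟩
      p ℕ.+ (q ℕ.+ t) ≡⟨ cong (p ℕ.+_) (ℕ.+-comm q t) ⟩
      p ℕ.+ (t ℕ.+ q) ≡⟨ ℕ.+-assoc p t q ⟨
      (p ℕ.+ t) ℕ.+ q ∎
      where open ≡-Reasoning

    -- The parameter is `a - p`. No root of the line lies before the start: `a < p` forces `b < q`,
    -- hence `a + b + 2 ≤ p + q ≤ n`, against the bound `n ≤ 1 + a + b` for roots.
    parameter : ∀ {x : Φ⁺A n} {a b} → At x a b → b ℕ.+ p ≡ a ℕ.+ q →
      ∃[ t ] (t < n × p ℕ.+ t ≡ a × q ℕ.+ t ≡ b)
    parameter {x} {a} {b} at e with p ℕ.≤? a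
    ... | yes p≤a = a ℕ.∸ p , ℕ.≤-<-trans (ℕ.m∸n≤m a p) (at-<ˡ {x = x} at) , p+t , ℕ.+-cancelʳ-≡ p _ _ (begin
        (q ℕ.+ (a ℕ.∸ p)) ℕ.+ p ≡⟨ ℕ.+-assoc q _ p ⟩
        q ℕ.+ ((a ℕ.∸ p) ℕ.+ p) ≡⟨ cong (q ℕ.+_) (ℕ.m∸n+n≡m p≤a) ⟩
        q ℕ.+ a                 ≡⟨ ℕ.+-comm q a ⟩
        a ℕ.+ q                 ≡⟨ e ⟨
        b ℕ.+ p                 ∎)
      where
      open ≡-Reasoning
      p+t : p ℕ.+ (a ℕ.∸ p) ≡ a
      p+t = ℕ.m+[n∸m]≡n p≤a
    ... | no p≰a = contradiction (begin-strict
        n                 ≤⟨ at-bound {x = x} at ⟩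
        suc a ℕ.+ b       <⟨ ℕ.+-mono-≤-< a<p b<q ⟩
        p ℕ.+ q           ≤⟨ p+q≤n ⟩
        n                 ∎) (ℕ.<-irrefl refl)
      where
      open ℕ.≤-Reasoning
      a<p : a < p
      a<p = ℕ.≰⇒> p≰a
      b<q : b < q
      b<q = ℕ.+-cancelʳ-< p b q (subst₂ _<_ (sym e) (ℕ.+-comm p q) (ℕ.+-monoˡ-< q a<p))

  module _ {k : ℤ} (k≡q-p : k ≡ + q - + p) where

    private
      restricted : Φ⁺A n → ℝ
      restricted x = if does (InFile? k x) then f x else 0ℝ

      inFile⇔ : ∀ {x : Φ⁺A n} {a b} → At x a b → (+ j x - + i x ≡ k) ⇔ (b ℕ.+ p ≡ a ℕ.+ q)
      inFile⇔ {x} {a} {b} (refl , refl) = mk⇔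
        (λ e → ℕ.suc-injective (to (trans e k≡q-p)))
        (λ e → trans (from (cong suc e)) (sym k≡q-p))
        where open Equivalence (+-difference (suc a) (suc b) p q)

      -- A root of the file is met by exactly one `t`, since `p + t` determines `t`; a root off the
      -- file, or a point that is no root, contributes zero for every `t`.
      restricted-spread : ∀ a b → ext 0ℝ restricted a b ≃ ∑[ t < n ] term (toℕ t) a b
      restricted-spread a b = spread (locate a b)
        where
        open ≃-Reasoning
        spread : Dec (∃[ x ] At {n} x a b) → ext 0ℝ restricted a b ≃ ∑[ t < n ] term (toℕ t) a b
        spread (no off) = R.trans (R.reflexive (ext-off 0ℝ restricted off))
          (R.sym (sum-zero {n} _ λ t → R.reflexive (term-outside (toℕ t) off)))
        spread (yes (x , at)) = R.trans (R.reflexive (ext-at 0ℝ restricted at)) on-cell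
          where
          on-cell : restricted x ≃ ∑[ t < n ] term (toℕ t) a b
          on-cell with InFile? k x
          ... | no ¬k = R.sym (sum-zero {n} _ λ t → R.reflexive (term-off λ { (pt , qt) →
              ¬k (Equivalence.from (inFile⇔ {x} at) (on-line (toℕ t) pt qt)) }))
          ... | yes e with parameter {x} at (Equivalence.to (inFile⇔ {x} at) e)
          ...   | t , t<n , pt , qt = R.sym (begin
              ∑[ s < n ] term (toℕ s) a b ≈⟨ sum-single {n} _ t′ (λ s s≢t → R.reflexive (term-off λ { (ps , _) →
                  s≢t (toℕ-injective (trans (ℕ.+-cancelˡ-≡ p _ _ (trans ps (sym pt))) (sym (toℕ-fromℕ< t<n)))) })) ⟩
              term (toℕ t′) a b           ≡⟨ cong (λ s → term s a b) (toℕ-fromℕ< t<n) ⟩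
              term t a b                  ≡⟨ term-on pt qt ⟩
              ext 0ℝ f a b                ≡⟨ ext-at 0ℝ f at ⟩
              f x                         ∎)
            where
            t′ = fromℕ< t<n

      term-collect : ∀ t → ∑[ a < n ] ∑[ b < n ] term t (toℕ a) (toℕ b) ≃ ext 0ℝ f (p ℕ.+ t) (q ℕ.+ t)
      term-collect t = collect (locate (p ℕ.+ t) (q ℕ.+ t))
        where
        open ≃-Reasoning
        collect : Dec (∃[ x ] At {n} x (p ℕ.+ t) (q ℕ.+ t)) →
          ∑[ a < n ] ∑[ b < n ] term t (toℕ a) (toℕ b) ≃ ext 0ℝ f (p ℕ.+ t) (q ℕ.+ t)
        zero-at : ¬ (∃[ x ] At {n} x (p ℕ.+ t) (q ℕ.+ t)) → ∀ a b → term t a b ≡ 0ℝ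
        zero-at off a b with (p ℕ.+ t ℕ.≟ a) ×-dec (q ℕ.+ t ℕ.≟ b)
        ... | yes (refl , refl) = trans (term-on refl refl) (ext-off 0ℝ f off)
        ... | no ¬e             = term-off ¬e
        collect (no off) = R.trans
          (sum-zero {n} _ λ a → sum-zero {n} _ λ b → R.reflexive (zero-at off (toℕ a) (toℕ b)))
          (R.reflexive (sym (ext-off 0ℝ f off)))
        collect (yes (x@(root a b _) , at@(ea , eb))) = begin
          ∑[ c < n ] ∑[ d < n ] term t (toℕ c) (toℕ d)
            ≈⟨ sum-single {n} _ a (λ c c≢a → sum-zero {n} _ λ d →
                 R.reflexive (term-off λ { (e , _) → c≢a (toℕ-injective (trans (sym e) (sym ea))) })) ⟩
          ∑[ d < n ] term t (toℕ a) (toℕ d)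
            ≈⟨ sum-single {n} _ b (λ d d≢b →
                 R.reflexive (term-off λ { (_ , e) → d≢b (toℕ-injective (trans (sym e) (sym eb))) })) ⟩
          term t (toℕ a) (toℕ b)       ≡⟨ term-on (sym ea) (sym eb) ⟩
          ext 0ℝ f (toℕ a) (toℕ b)     ≡⟨ ext-at 0ℝ f {x} (refl , refl) ⟩
          f x                          ≡⟨ ext-at 0ℝ f at ⟨
          ext 0ℝ f (p ℕ.+ t) (q ℕ.+ t) ∎

    -- Each entry of the square is spread over `t`, the sum over `t` is moved outermost by two
    -- exchanges, and for each `t` only one entry survives.
    sumΦ-file : sumΦ (InFile? k) f ≃ ∑[ t < n ] ext 0ℝ f (p ℕ.+ toℕ t) (q ℕ.+ toℕ t)
    sumΦ-file = begin
      ∑[ a < n ] ∑[ b < n ] extend0 (InFile? k) f a b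
        ≈⟨ sum-cong-≋ {n} (λ a → sum-cong-≋ {n} λ b →
             R.trans (R.reflexive (extend0≡ext (InFile? k) f a b)) (restricted-spread (toℕ a) (toℕ b))) ⟩
      ∑[ a < n ] ∑[ b < n ] ∑[ t < n ] term (toℕ t) (toℕ a) (toℕ b)
        ≈⟨ sum-cong-≋ {n} (λ a → ∑-comm {n} {n} λ b t → term (toℕ t) (toℕ a) (toℕ b)) ⟩
      ∑[ a < n ] ∑[ t < n ] ∑[ b < n ] term (toℕ t) (toℕ a) (toℕ b)
        ≈⟨ ∑-comm {n} {n} (λ a t → ∑[ b < n ] term (toℕ t) (toℕ a) (toℕ b)) ⟩
      ∑[ t < n ] ∑[ a < n ] ∑[ b < n ] term (toℕ t) (toℕ a) (toℕ b)
        ≈⟨ sum-cong-≋ {n} (λ t → term-collect (toℕ t)) ⟩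
      ∑[ t < n ] ext 0ℝ f (p ℕ.+ toℕ t) (q ℕ.+ toℕ t) ∎
      where open ≃-Reasoning

-- Toggle identities for truth values.

val : Bool → ℝ
val b = if b then 1ℝ else 0ℝ

-- Here `x` is membership of a root, `p` that of all its lower covers and `u`, `v` that of its upper
-- covers. The implications coming from the ideal leave six cases, each a computation with constant
-- rational sequences.
val-toggle : ∀ p x u v → (T x → T p) → (T u → T x) → (T v → T x) →
  -ℝ 1ℝ *ℝ (val (p ∧ not x) -ℝ val (x ∧ not u ∧ not v))
    ≃ (val x +ℝ val x -ℝ (val u +ℝ val v)) -ℝ (val p -ℝ val (u ∧ v))
val-toggle false true  u     v     x⇒p u⇒x v⇒x = ⊥-elim (x⇒p tt)
val-toggle p     false true  v     x⇒p u⇒x v⇒x = ⊥-elim (u⇒x tt)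
val-toggle p     false false true  x⇒p u⇒x v⇒x = ⊥-elim (v⇒x tt)
val-toggle false false false false x⇒p u⇒x v⇒x = ≗⇒≃ λ _ → refl
val-toggle true  false false false x⇒p u⇒x v⇒x = ≗⇒≃ λ _ → refl
val-toggle true  true  false false x⇒p u⇒x v⇒x = ≗⇒≃ λ _ → refl
val-toggle true  true  false true  x⇒p u⇒x v⇒x = ≗⇒≃ λ _ → refl
val-toggle true  true  true  false x⇒p u⇒x v⇒x = ≗⇒≃ λ _ → refl
val-toggle true  true  true  true  x⇒p u⇒x v⇒x = ≗⇒≃ λ _ → refl

-- The counterpart for a diagonal point that is not a root: once `p` fails, the implications make
-- `x`, `u` and `v` fail too, and every term is zero.
val-no-toggle : ∀ p x u v → (T x → T p) → (T u → T x) → (T v → T x) → ¬ T p →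
  0ℝ ≃ (val x +ℝ val x -ℝ (val u +ℝ val v)) -ℝ (val p -ℝ val (u ∧ v))
val-no-toggle true  x     u     v     x⇒p u⇒x v⇒x ¬p = contradiction tt ¬p
val-no-toggle false true  u     v     x⇒p u⇒x v⇒x ¬p = ⊥-elim (x⇒p tt)
val-no-toggle false false true  v     x⇒p u⇒x v⇒x ¬p = ⊥-elim (u⇒x tt)
val-no-toggle false false false true  x⇒p u⇒x v⇒x ¬p = ⊥-elim (v⇒x tt)
val-no-toggle false false false false x⇒p u⇒x v⇒x ¬p = ≗⇒≃ λ _ → refl

-- Toggleability read off from the covers of a root.

module _ {n : ℕ} (I : 𝒥 n) where

  member : ℕ → ℕ → Bool
  member = ext false (mem I)

  member-cell : ∀ a b → T (member a b) → ∃[ x ] (At x a b × x ∈ I)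
  member-cell a b h = found (locate a b)
    where
    found : Dec (∃[ x ] At x a b) → ∃[ x ] (At x a b × x ∈ I)
    found (yes (x , at)) = x , at , subst T (ext-at false (mem I) at) h
    found (no off)       = ⊥-elim (subst T (ext-off false (mem I) off) h)

  ∈⇒member : ∀ {x a b} → At x a b → x ∈ I → T (member a b)
  ∈⇒member at = subst T (sym (ext-at false (mem I) at))

  member⇒∈ : ∀ {x a b} → At x a b → T (member a b) → x ∈ I
  member⇒∈ at = subst T (ext-at false (mem I) at)

  -- Membership of `(c , d)` makes it a root, so `a` and `b` are below `n`; together with the height
  -- bound this makes `(a , b)` a root, and closure of the ideal applies.
  member-down : ∀ a b c d → a ≤ c → b ≤ d → n ≤ suc (a ℕ.+ b) → T (member c d) → T (member a b)
  member-down a b c d a≤c b≤d h m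
    with y , at@(refl , refl) , y∈I ← member-cell c d m
    with x , at′@(refl , refl) ← cell (ℕ.≤-<-trans a≤c (at-<ˡ {x = y} at)) (ℕ.≤-<-trans b≤d (at-<ʳ {x = y} at)) h
    = ∈⇒member {x} at′ (downClosed I {x} {y} (s≤s a≤c , s≤s b≤d) y∈I)

  T⁺-bottom : ∀ {x a b} → At x a b → n ≡ suc (a ℕ.+ b) → T⁺ x I ≡ val (not (member a b))
  T⁺-bottom {x} {a} {b} at@(refl , refl) e =
    cong val (does-⇔ (mk⇔ to from) (isMinimalIn? (λ y → ¬? (y ∈? I)) x) (¬? (T? (member a b))))
    where
    to : IsMinimalIn (λ y → ¬ y ∈ I) x → ¬ T (member a b)
    to (x∉I , _) = x∉I ∘ member⇒∈ {x} at
    from : ¬ T (member a b) → IsMinimalIn (λ y → ¬ y ∈ I) x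
    from ¬m = ¬m ∘ ∈⇒member {x} at , λ { y@(root c d _) _ (s≤s c≤a , s≤s d≤b) →
      -- A root of least height has only itself below it: `c ≤ a`, `d ≤ b` and `a + b ≤ c + d` force
      -- equality in both coordinates.
      let a+b≤c+d = ℕ.s≤s⁻¹ (subst (_≤ suc (toℕ c ℕ.+ toℕ d)) e (at-bound {x = y} (refl , refl)))
          a≤c = ℕ.+-cancelʳ-≤ b a (toℕ c) (ℕ.≤-trans a+b≤c+d (ℕ.+-monoʳ-≤ (toℕ c) d≤b))
          b≤d = ℕ.+-cancelˡ-≤ a b (toℕ d) (ℕ.≤-trans a+b≤c+d (ℕ.+-monoˡ-≤ (toℕ d) c≤a))
      in at-unique {x = y} {x} (ℕ.≤-antisym c≤a a≤c , ℕ.≤-antisym d≤b b≤d) at }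

  -- The lower covers `(suc a , b)` and `(a , suc b)` have equal height, so `h` makes both of them
  -- roots. Everything strictly below `x` lies below one of them, so closure of the ideal reduces
  -- minimality in the complement to these two.
  T⁺-above : ∀ {x a b} → At x (suc a) (suc b) → n ≤ suc (suc a ℕ.+ b) →
    T⁺ x I ≡ val ((member (suc a) b ∧ member a (suc b)) ∧ not (member (suc a) (suc b)))
  T⁺-above {x} {a} {b} at h = cong val (does-⇔ (mk⇔ to from) (isMinimalIn? (λ y → ¬? (y ∈? I)) x)
    ((T? (member (suc a) b) ×-dec T? (member a (suc b))) ×-dec ¬? (T? (member (suc a) (suc b)))))
    where
    to : IsMinimalIn (λ y → ¬ y ∈ I) x →
      (T (member (suc a) b) × T (member a (suc b))) × ¬ T (member (suc a) (suc b))
    to (x∉I , minimal) = (below (ℕ.≤-refl {suc a}) (ℕ.n≤1+n b) h (λ { (_ , e) → ℕ.1+n≢n (sym e) })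
                       , below (ℕ.n≤1+n a) (ℕ.≤-refl {suc b}) (subst (n ≤_) (cong suc (sym (ℕ.+-suc a b))) h)
                           (λ { (e , _) → ℕ.1+n≢n (sym e) }))
                       , x∉I ∘ member⇒∈ {x} at
      where
      below : ∀ {c d} → c ≤ suc a → d ≤ suc b → n ≤ suc (c ℕ.+ d) → ¬ (c ≡ suc a × d ≡ suc b) → T (member c d)
      below {c} {d} c≤ d≤ h′ ≢x
        with y , aty ← cell {n} (ℕ.≤-<-trans c≤ (at-<ˡ {x = x} at)) (ℕ.≤-<-trans d≤ (at-<ʳ {x = x} at)) h′
        with y ∈? I
      ... | yes y∈I = ∈⇒member {y} aty y∈I
      -- A lower cover outside the ideal would equal `x` by minimality, but its coordinates differ.
      ... | no y∉I with refl ← minimal y y∉I (subst₂ (λ c d → suc c ≤ i x × suc d ≤ j x)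
                                  (sym (proj₁ aty)) (sym (proj₂ aty))
                                  (subst₂ (λ a b → suc c ≤ suc a × suc d ≤ suc b)
                                    (sym (proj₁ at)) (sym (proj₂ at)) (s≤s c≤ , s≤s d≤)))
                   = contradiction (trans (sym (proj₁ aty)) (proj₁ at) , trans (sym (proj₂ aty)) (proj₂ at)) ≢x
    from : (T (member (suc a) b) × T (member a (suc b))) × ¬ T (member (suc a) (suc b)) →
      IsMinimalIn (λ y → ¬ y ∈ I) x
    from ((m₁ , m₂) , ¬m) = ¬m ∘ ∈⇒member {x} at , minimal
      where
      minimal : ∀ y → ¬ y ∈ I → y ⊑ x → y ≡ x
      minimal y@(root c d _) y∉I (s≤s c≤ , s≤s d≤)
        with ℕ.m≤n⇒m<n∨m≡n (subst (toℕ c ≤_) (proj₁ at) c≤) | ℕ.m≤n⇒m<n∨m≡n (subst (toℕ d ≤_) (proj₂ at) d≤)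
      ... | inj₁ (s≤s c≤a) | _ = contradiction (member⇒∈ {y} (refl , refl)
              (member-down (toℕ c) (toℕ d) a (suc b) c≤a (subst (toℕ d ≤_) (proj₂ at) d≤) (at-bound {x = y} (refl , refl)) m₂)) y∉I
      ... | inj₂ _ | inj₁ (s≤s d≤b) = contradiction (member⇒∈ {y} (refl , refl)
              (member-down (toℕ c) (toℕ d) (suc a) b (subst (toℕ c ≤_) (proj₁ at) c≤) d≤b (at-bound {x = y} (refl , refl)) m₁)) y∉I
      ... | inj₂ e | inj₂ e′ = at-unique {x = y} {x} (e , e′) at

  -- Any root strictly above `x` lies above one of the two upper covers. A cover outside the square
  -- is no root; there `member` is `false`, so its condition holds automatically.
  T⁻-member : ∀ {x a b} → At x a b →
    T⁻ x I ≡ val (member a b ∧ not (member (suc a) b) ∧ not (member a (suc b)))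
  T⁻-member {x} {a} {b} at@(refl , refl) = cong val (does-⇔ (mk⇔ to from) (isMaximalIn? (_∈? I) x)
    (T? (member a b) ×-dec ¬? (T? (member (suc a) b)) ×-dec ¬? (T? (member a (suc b)))))
    where
    to : IsMaximalIn (_∈ I) x → T (member a b) × (¬ T (member (suc a) b)) × (¬ T (member a (suc b)))
    to (x∈I , maximal) = ∈⇒member {x} at x∈I , above₁ , above₂
      where
      above₁ : ¬ T (member (suc a) b)
      above₁ m with y , (e , e′) , y∈I ← member-cell (suc a) b m
               with refl ← maximal y y∈I (s≤s (subst (a ≤_) (sym e) (ℕ.n≤1+n a)) , s≤s (ℕ.≤-reflexive (sym e′)))
               = ℕ.1+n≢n (sym e)
      above₂ : ¬ T (member a (suc b))
      above₂ m with y , (e , e′) , y∈I ← member-cell a (suc b) m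
               with refl ← maximal y y∈I (s≤s (ℕ.≤-reflexive (sym e)) , s≤s (subst (b ≤_) (sym e′) (ℕ.n≤1+n b)))
               = ℕ.1+n≢n (sym e′)
    from : T (member a b) × (¬ T (member (suc a) b)) × (¬ T (member a (suc b))) → IsMaximalIn (_∈ I) x
    from (m , ¬m₁ , ¬m₂) = member⇒∈ {x} at m , maximal
      where
      h : n ≤ suc (a ℕ.+ b)
      h = at-bound {x = x} at
      maximal : ∀ y → y ∈ I → x ⊑ y → y ≡ x
      maximal y@(root c d _) y∈I (s≤s a≤ , s≤s b≤) with ℕ.m≤n⇒m<n∨m≡n a≤ | ℕ.m≤n⇒m<n∨m≡n b≤
      ... | inj₁ a< | _ = contradiction
              (member-down (suc a) b (toℕ c) (toℕ d) a< b≤ (ℕ.m≤n⇒m≤1+n h) (∈⇒member {y} (refl , refl) y∈I)) ¬m₁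
      ... | inj₂ _ | inj₁ b< = contradiction
              (member-down a (suc b) (toℕ c) (toℕ d) a≤ b< (subst (n ≤_) (cong suc (sym (ℕ.+-suc a b))) (ℕ.m≤n⇒m≤1+n h))
                (∈⇒member {y} (refl , refl) y∈I)) ¬m₂
      ... | inj₂ e | inj₂ e′ = at-unique {x = y} {x} (sym e , sym e′) at

-- Coefficients of the toggles and the telescoping along the file.

-1[_] : ∀ {A : Set} → Dec A → ℝ
-1[ d ] = if does d then -ℝ 1ℝ else 0ℝ

sumΦ-restrict : ∀ {n} {Q : Pred (Φ⁺A n) 0ℓ} (Q? : Decidable Q) (f : Φ⁺A n → ℝ) →
  sumΦ U? (λ y → -1[ Q? y ] *ℝ f y) ≃ sumΦ Q? (λ y → -ℝ 1ℝ *ℝ f y)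
sumΦ-restrict {n} Q? f = sum-cong-≋ {n} λ a → sum-cong-≋ {n} λ b → entry a b
  where
  scale : ∀ c r → (if c then -ℝ 1ℝ else 0ℝ) *ℝ r ≃ (if c then -ℝ 1ℝ *ℝ r else 0ℝ)
  scale true  r = R.refl
  scale false r = R.zeroˡ r
  entry : ∀ a b → extend0 U? (λ y → -1[ Q? y ] *ℝ f y) a b ≃ extend0 Q? (λ y → -ℝ 1ℝ *ℝ f y) a b
  entry a b with InΦ⁺? a b
  ... | no _  = R.refl
  ... | yes h = scale (does (Q? (root a b h))) (f (root a b h))

-- n is kept as a variable: for n = 1 + m + q the sums over Fin n would unfold, which
-- makes conversion checking in ℝ blow up.
module _ {n : ℕ} (m q : ℕ) (n≡1+m+q : n ≡ suc (m ℕ.+ q)) (I : 𝒥 n) where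

  private
    x u v p : ℕ → Bool
    x t = member I (m ℕ.+ t) (q ℕ.+ t)
    u t = member I (suc m ℕ.+ t) (q ℕ.+ t)
    v t = member I (m ℕ.+ t) (suc q ℕ.+ t)
    -- The starting root `(m , q)` has least height and no lower covers, so this is the empty
    -- conjunction.
    p zero    = true
    p (suc t) = u t ∧ v t

    above : ∀ t → n ≤ suc ((m ℕ.+ t) ℕ.+ (q ℕ.+ t))
    above t = ℕ.≤-trans (ℕ.≤-reflexive n≡1+m+q) (s≤s (ℕ.+-mono-≤ (ℕ.m≤m+n m t) (ℕ.m≤m+n q t)))

    x-suc : ∀ t → x (suc t) ≡ member I (suc (m ℕ.+ t)) (suc (q ℕ.+ t))
    x-suc t = cong₂ (member I) (ℕ.+-suc m t) (ℕ.+-suc q t)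

    u⇒x : ∀ t → T (u t) → T (x t)
    u⇒x t = member-down I (m ℕ.+ t) (q ℕ.+ t) (suc m ℕ.+ t) (q ℕ.+ t) (ℕ.n≤1+n _) ℕ.≤-refl (above t)

    v⇒x : ∀ t → T (v t) → T (x t)
    v⇒x t = member-down I (m ℕ.+ t) (q ℕ.+ t) (m ℕ.+ t) (suc q ℕ.+ t) ℕ.≤-refl (ℕ.n≤1+n _) (above t)

    x⇒p : ∀ t → T (x t) → T (p t)
    x⇒p zero    _ = tt
    x⇒p (suc t) h = Equivalence.from (T-∧ {u t} {v t})
      ( member-down I (suc m ℕ.+ t) (q ℕ.+ t) (suc m ℕ.+ t) (suc q ℕ.+ t) ℕ.≤-refl (ℕ.n≤1+n _) (ℕ.m≤n⇒m≤1+n (above t)) h′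
      , member-down I (m ℕ.+ t) (suc q ℕ.+ t) (suc m ℕ.+ t) (suc q ℕ.+ t) (ℕ.n≤1+n _) ℕ.≤-refl
          (subst (n ≤_) (cong suc (sym (ℕ.+-suc (m ℕ.+ t) (q ℕ.+ t)))) (ℕ.m≤n⇒m≤1+n (above t))) h′ )
      where
      h′ : T (member I (suc (m ℕ.+ t)) (suc (q ℕ.+ t)))
      h′ = subst T (x-suc t) h

    -- If both upper covers at step `t` are roots, the first bounds `m + t + 1` and the second
    -- `q + t + 1` below `n`, so the next diagonal point is a root. Conversely read, `p` is false
    -- once the diagonal has left the square.
    p⇒cell : ∀ t → T (p t) → ∃[ y ] At {n} y (m ℕ.+ t) (q ℕ.+ t)
    p⇒cell zero    _ = cell (subst₂ _<_ (sym (ℕ.+-identityʳ m)) (sym n≡1+m+q) (s≤s (ℕ.m≤m+n m q)))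
                            (subst₂ _<_ (sym (ℕ.+-identityʳ q)) (sym n≡1+m+q) (s≤s (ℕ.m≤n+m q m))) (above 0)
    p⇒cell (suc t) h
      with hu , hv ← Equivalence.to (T-∧ {u t} {v t}) h
      with y , aty , _ ← member-cell I (suc m ℕ.+ t) (q ℕ.+ t) hu | z , atz , _ ← member-cell I (m ℕ.+ t) (suc q ℕ.+ t) hv
      = cell (subst (_< n) (sym (ℕ.+-suc m t)) (at-<ˡ {x = y} aty))
             (subst (_< n) (sym (ℕ.+-suc q t)) (at-<ʳ {x = z} atz)) (above (suc t))

    T⁺-diagonal : ∀ t {y} → At y (m ℕ.+ t) (q ℕ.+ t) → T⁺ y I ≡ val (p t ∧ not (x t))
    T⁺-diagonal zero    {y} at = T⁺-bottom I {y} at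
      (trans n≡1+m+q (cong suc (sym (cong₂ ℕ._+_ (ℕ.+-identityʳ m) (ℕ.+-identityʳ q)))))
    T⁺-diagonal (suc t) {y} (e , e′) = trans
      (T⁺-above I {y} (trans e (ℕ.+-suc m t) , trans e′ (ℕ.+-suc q t)) (ℕ.m≤n⇒m≤1+n (above t)))
      (cong (λ c → val (p (suc t) ∧ not c)) (sym (x-suc t)))

    σ : ℕ → ℝ
    σ t = ext 0ℝ (λ y → -ℝ 1ℝ *ℝ Tog y I) (m ℕ.+ t) (q ℕ.+ t)

    -- At a root the two toggle formulas apply; past the end of the diagonal `σ` takes its default 0
    -- and `p⇒cell` shows that `p` is false.
    σ-step : ∀ t → σ t ≃ (val (x t) +ℝ val (x t) -ℝ (val (u t) +ℝ val (v t))) -ℝ (val (p t) -ℝ val (p (suc t)))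
    σ-step t = step (locate (m ℕ.+ t) (q ℕ.+ t))
      where
      step : Dec (∃[ y ] At {n} y (m ℕ.+ t) (q ℕ.+ t)) →
        σ t ≃ (val (x t) +ℝ val (x t) -ℝ (val (u t) +ℝ val (v t))) -ℝ (val (p t) -ℝ val (p (suc t)))
      step (yes (y , at)) = R.trans
        (R.reflexive (trans (ext-at 0ℝ _ at)
          (cong₂ (λ r s → -ℝ 1ℝ *ℝ (r -ℝ s)) (T⁺-diagonal t {y} at) (T⁻-member I {y} at))))
        (val-toggle (p t) (x t) (u t) (v t) (x⇒p t) (u⇒x t) (v⇒x t))
      step (no off) = R.trans (R.reflexive (ext-off 0ℝ _ off))
        (val-no-toggle (p t) (x t) (u t) (v t) (x⇒p t) (u⇒x t) (v⇒x t) (off ∘ p⇒cell t))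

    -- The diagonal has left the square after `n` steps, as `m + n < n` is impossible; this removes
    -- the upper boundary term.
    p-top : val (p n) ≡ 0ℝ
    p-top = cong val (dec-false (T? (p n)) λ h →
      let y , at = p⇒cell n h in ℕ.m+n≮n m n (at-<ˡ {x = y} at))

    file-val : ∀ a b → a ℕ.+ b ≤ n → ∀ {k} → k ≡ + b - + a →
      file k I ≃ ∑[ t < n ] val (member I (a ℕ.+ toℕ t) (b ℕ.+ toℕ t))
    file-val a b h {k} e = R.trans (sumΦ-file a b h (λ y → 𝟙 y I) e)
      (sum-cong-≋ {n} λ t → R.reflexive (ext-natural val false (mem I) (a ℕ.+ toℕ t) (b ℕ.+ toℕ t)))

  module _ {k : ℤ} (k≡q-m : k ≡ + q - + m) where

    -- Both sides become sums over `t < n`, the file sums through `x`, `u`, `v` and the toggles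
    -- through `σ`; the constant 1 is the boundary value `val (p 0)`.
    file-second-difference :
      2ℝ *ℝ file k I -ℝ file (k - + 1) I -ℝ file (k + + 1) I -ℝ 1ℝ
        ≃ sumΦ U? (λ y → -1[ InFile? k y ] *ℝ Tog y I)
    file-second-difference = begin
      2ℝ *ℝ file k I -ℝ file (k - + 1) I -ℝ file (k + + 1) I -ℝ 1ℝ
        ≈⟨ telescoped (file k I) (file (k - + 1) I) (file (k + + 1) I)
             (∑[ t < n ] val (x (toℕ t))) (∑[ t < n ] val (u (toℕ t))) (∑[ t < n ] val (v (toℕ t)))
             (∑[ t < n ] σ (toℕ t)) (val (p n))
             (file-val m q m+q≤n k≡q-m)
             -- The neighbouring files start at the upper covers of `(m , q)`, whose coordinates add
             -- up to exactly `n`, the largest sum for which no root can precede the start.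
             (file-val (suc m) q (ℕ.≤-reflexive (sym n≡1+m+q)) (trans (cong (_- + 1) k≡q-m) (lower (+ m) (+ q))))
             (file-val m (suc q) (ℕ.≤-reflexive (trans (ℕ.+-suc m q) (sym n≡1+m+q)))
               (trans (cong (_+ + 1) k≡q-m) (raise (+ m) (+ q))))
             (∑-telescope n (val ∘ x) (val ∘ u) (val ∘ v) (val ∘ p) σ σ-step)
             p-top ⟩
      ∑[ t < n ] σ (toℕ t)                            ≈⟨ collected ⟨
      sumΦ (InFile? k) (λ y → -ℝ 1ℝ *ℝ Tog y I)       ≈⟨ restricted ⟨
      sumΦ U? (λ y → -1[ InFile? k y ] *ℝ Tog y I)    ∎
      where
      open ≃-Reasoning
      m+q≤n : m ℕ.+ q ≤ n
      m+q≤n = subst (m ℕ.+ q ≤_) (sym n≡1+m+q) (ℕ.n≤1+n (m ℕ.+ q))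
      collected : sumΦ (InFile? k) (λ y → -ℝ 1ℝ *ℝ Tog y I) ≃ ∑[ t < n ] σ (toℕ t)
      collected = sumΦ-file m q m+q≤n (λ y → -ℝ 1ℝ *ℝ Tog y I) k≡q-m
      restricted : sumΦ {n} U? (λ y → -1[ InFile? k y ] *ℝ Tog y I) ≃ sumΦ (InFile? k) (λ y → -ℝ 1ℝ *ℝ Tog y I)
      restricted = sumΦ-restrict {n} {λ y → + j y - + i y ≡ k} (InFile? k) (λ y → Tog y I)
      module Z = ℤ-Solver.+-*-Solver
      telescoped : ∀ f g h X U V S P → f ≃ X → g ≃ U → h ≃ V →
        2ℝ *ℝ X -ℝ U -ℝ V -ℝ 1ℝ ≃ S -ℝ P → P ≡ 0ℝ → 2ℝ *ℝ f -ℝ g -ℝ h -ℝ 1ℝ ≃ S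
      telescoped f g h X U V S _ f≃X g≃U h≃V eq refl = R.trans
        (R.+-congʳ (R.+-cong (R.+-cong (R.*-congˡ f≃X) (R.-‿cong g≃U)) (R.-‿cong h≃V)))
        (R.trans eq (≗⇒≃ λ i → solve 1 (λ a → a :- con ℚ.0ℚ := a) refl (seq S i)))
        where open +-*-Solver
      lower : ∀ m q → (q - m) - + 1 ≡ q - (+ 1 + m)
      lower = Z.solve 2 (λ m q → (q Z.:- m) Z.:- Z.con (+ 1) Z.:= q Z.:- (Z.con (+ 1) Z.:+ m)) refl
      raise : ∀ m q → (q - m) + + 1 ≡ (+ 1 + q) - m
      raise = Z.solve 2 (λ m q → (q Z.:- m) Z.:+ Z.con (+ 1) Z.:= (Z.con (+ 1) Z.:+ q) Z.:- m) refl

file-second-difference-≡ᵀ : ∀ {n} m q → n ≡ suc (m ℕ.+ q) → ∀ {k} → k ≡ + q - + m →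
  (λ (I : 𝒥 n) → 2ℝ *ℝ file k I -ℝ file (k - + 1) I -ℝ file (k + + 1) I) ≡ᵀ (λ _ → 1ℝ)
file-second-difference-≡ᵀ m q e {k} k≡ =
  (λ y → -1[ InFile? k y ]) , λ I → file-second-difference m q e I k≡

theorem3p28 : ∀ (n : ℕ) → 1 ≤ n →
    ∀ (k : ℤ) → (∃[ m ] (m < n × k ≡ (+ n - + 1) - + 2 * + m)) →
    (λ (I : 𝒥 n) → 2ℝ *ℝ file k I -ℝ file (k - + 1) I -ℝ file (k + + 1) I) ≡ᵀ (λ _ → 1ℝ)
theorem3p28 n _ k (m , m<n , k≡) =
  -- With `q = n - 1 - m`, the index `(n - 1) - 2m` equals `q - m`, and `(m , q)` is the root of
  -- least height on this file.
  let q , 1+m+q≡n = ℕ.m≤n⇒∃[o]m+o≡n m<n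
  in file-second-difference-≡ᵀ m q (sym 1+m+q≡n)
       (trans k≡ (trans (cong (λ s → (+ s - + 1) - + 2 * + m) (sym 1+m+q≡n)) (index (+ m) (+ q))))
  where
  open ℤ-Solver.+-*-Solver
  index : ∀ m q → ((+ 1 + (m + q)) - + 1) - + 2 * m ≡ q - m
  index = solve 2 (λ m q → ((con (+ 1) :+ (m :+ q)) :- con (+ 1)) :- con (+ 2) :* m := q :- m) refl
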